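{- Any $\varepsilon$-node-differentially private algorithm to compute the weight of a maximum weight matching in an incremental graph sequence of length $T$ must have additive error $\Omega(W\log T)$ when the edge weights are in $\{1,\dots,W\}$ and $W$ is a publicly known parameter. This holds even with $\varepsilon=1$.
   Context: Graphs are undirected and edge-weighted. An incremental graph sequence $(G_1,\dots,G_T)$ arises from an initial (possibly non-empty) graph $G_0$ by inserting at each time $t$ a set $\partial V_t^+$ of nodes and a set $\partial E_t^+$ of edges (no deletions). Two incremental sequences are node-adjacent (event-level) if they have the same length and initial graph, and (up to exchanging them) there are a node $v^*$ and a time $t^*$ with $\partial V_t^+=\partial V_t'^+$ for $t\ne t^*$, $\partial V_{t^*}'^+\subseteq\partial V_{t^*}^+$ and $\partial V_{t^*}^+\setminus\partial V_{t^*}'^+=\{v^*\}$; moreover every edge in $\partial E_t^+$ is incident to at least one node of $\partial V_t^+$, and $\partial E_t'^+$ is the maximal subset of $\partial E_t^+$ containing no edge incident to $v^*$. The algorithm is randomized and outputs a real number after each time step, an estimate of the value for the current graph. It is $\varepsilon$-node-differentially private if $\Pr[\mathcal A(\mathcal G)\in S]\le e^\varepsilon\Pr[\mathcal A(\mathcal G')\in S]$ for all node-adjacent $\mathcal G,\mathcal G'$ and all sets $S$ of possible output sequences. The additive error at a time step is the absolute difference between the output and the true value. -}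

module Defs where

open import Algebra.Bundles using (CommutativeRing; Semiring)
import Algebra.Definitions.RawSemiring as RawSemiringDefinitions
open import Data.Empty using (⊥)
open import Data.Fin.Base as Fin using (Fin; zero; suc; toℕ)
open import Data.List.Base using (List; _++_; map; sum)
open import Data.List.Membership.Propositional using (_∈_; _∉_)
open import Data.List.Relation.Binary.BagAndSetEquality using (_∼[_]_; set)
open import Data.List.Relation.Binary.Disjoint.Propositional using (Disjoint)
open import Data.List.Relation.Binary.Subset.Propositional using (_⊆_)
open import Data.List.Relation.Unary.AllPairs using (AllPairs)
open import Data.Nat.Base as ℕ using (ℕ; zero; suc; _!)
open import Data.Product.Base using (_×_; ∃; ∃-syntax)
open import Data.Sum.Base using (_⊎_)
open import Function.Base using (_∘_)
open import Function.Bundles using (_⇔_)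
open import Level using (0ℓ)
open import Relation.Binary.Core using (Rel)
open import Relation.Binary.PropositionalEquality.Core using (_≡_; _≢_)
open import Relation.Binary.Structures using (IsStrictPartialOrder)
open import Relation.Nullary.Negation.Core using (¬_)
import Relation.Unary as Pred

Node : Set
Node = ℕ

-- The endpoints of an undirected edge are stored in increasing order, so that
-- each weighted edge {u, v} has exactly one representation.

record Edge : Set where
  constructor edge
  field
    lo hi  : Node
    .lo<hi : lo ℕ.< hi
    weight : ℕ

open Edge public

Incident : Node → Edge → Set
Incident v e = v ≡ lo e ⊎ v ≡ hi e

-- Lists stand for finite sets here: order and multiplicity carry no meaning,
-- and sets are compared with _∼[ set ]_.

record Graph : Set where
  constructor graph
  field
    nodes : List Node
    edges : List Edge

open Graph public

record IsWeightedGraph (W : ℕ) (G : Graph) : Set where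
  field
    endpoints : ∀ {e} → e ∈ edges G → lo e ∈ nodes G × hi e ∈ nodes G
    simple    : ∀ {e f} → e ∈ edges G → f ∈ edges G →
                lo e ≡ lo f → hi e ≡ hi f → weight e ≡ weight f
    weights   : ∀ {e} → e ∈ edges G → 1 ℕ.≤ weight e × weight e ℕ.≤ W

VertexDisjoint : Rel Edge 0ℓ
VertexDisjoint e f = ∀ v → ¬ (Incident v e × Incident v f)

-- AllPairs excludes repetitions too, an edge not being disjoint from itself.

IsMatching : Graph → List Edge → Set
IsMatching G M = M ⊆ edges G × AllPairs VertexDisjoint M

totalWeight : List Edge → ℕ
totalWeight = sum ∘ map weight

IsMaxMatchingWeight : Graph → ℕ → Set
IsMaxMatchingWeight G m =
  (∃[ M ] (IsMatching G M × totalWeight M ≡ m)) ×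
  (∀ M → IsMatching G M → totalWeight M ℕ.≤ m)

record Insertion : Set where
  constructor insertion
  field
    ∂V : List Node
    ∂E : List Edge

open Insertion public

insert : Graph → Insertion → Graph
insert G δ = graph (∂V δ ++ nodes G) (∂E δ ++ edges G)

graphBefore : ∀ {T} → Graph → (Fin T → Insertion) → Fin T → Graph
graphBefore G δ zero    = G
graphBefore G δ (suc t) = graphBefore (insert G (δ zero)) (δ ∘ suc) t

graphAfter : ∀ {T} → Graph → (Fin T → Insertion) → Fin T → Graph
graphAfter G δ t = insert (graphBefore G δ t) (δ t)

record IncrementalSequence (W T : ℕ) : Set where
  field
    initial     : Graph
    insertions  : Fin T → Insertion
    initial-ok  : IsWeightedGraph W initial
    fresh-nodes : ∀ t → Disjoint (∂V (insertions t))
                                 (nodes (graphBefore initial insertions t))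
    fresh-edges : ∀ t → Disjoint (∂E (insertions t))
                                 (edges (graphBefore initial insertions t))
    after-ok    : ∀ t → IsWeightedGraph W (graphAfter initial insertions t)

  current : Fin T → Graph
  current = graphAfter initial insertions

open IncrementalSequence public using (initial; insertions; current)

SameGraph : Rel Graph 0ℓ
SameGraph G H = nodes G ∼[ set ] nodes H × edges G ∼[ set ] edges H

SameInsertion : Rel Insertion 0ℓ
SameInsertion δ δ′ = ∂V δ ∼[ set ] ∂V δ′ × ∂E δ ∼[ set ] ∂E δ′

AgreeUpTo : ∀ {W T} → Fin T → Rel (IncrementalSequence W T) 0ℓ
AgreeUpTo t 𝒢 𝒢′ =
  SameGraph (initial 𝒢) (initial 𝒢′) ×
  (∀ s → s Fin.≤ t → SameInsertion (insertions 𝒢 s) (insertions 𝒢′ s))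

newNodes : ∀ {W T} → IncrementalSequence W T → Fin T → List Node
newNodes 𝒢 t = ∂V (insertions 𝒢 t)

newEdges : ∀ {W T} → IncrementalSequence W T → Fin T → List Edge
newEdges 𝒢 t = ∂E (insertions 𝒢 t)

-- 𝒢′ arises from 𝒢 by omitting the node v* inserted at time t*.

record NodeOmitted {W T : ℕ} (𝒢 𝒢′ : IncrementalSequence W T) : Set where
  field
    same-initial : SameGraph (initial 𝒢) (initial 𝒢′)
    v*           : Node
    t*           : Fin T
    other-times  : ∀ t → t ≢ t* → newNodes 𝒢 t ∼[ set ] newNodes 𝒢′ t
    subset       : newNodes 𝒢′ t* ⊆ newNodes 𝒢 t*
    difference   : ∀ v → (v ∈ newNodes 𝒢 t* × v ∉ newNodes 𝒢′ t*) ⇔ v ≡ v*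
    incident     : ∀ t {e} → e ∈ newEdges 𝒢 t →
                   ∃[ v ] (v ∈ newNodes 𝒢 t × Incident v e)
    -- the largest subset of newEdges 𝒢 t without edges incident to v*
    edges-kept   : ∀ t e → e ∈ newEdges 𝒢′ t ⇔ (e ∈ newEdges 𝒢 t × ¬ Incident v* e)

NodeAdjacent : ∀ {W T} → Rel (IncrementalSequence W T) 0ℓ
NodeAdjacent 𝒢 𝒢′ = NodeOmitted 𝒢 𝒢′ ⊎ NodeOmitted 𝒢′ 𝒢

record OrderedField : Set₁ where
  field
    commutativeRing : CommutativeRing 0ℓ 0ℓ

  open CommutativeRing commutativeRing public
  open RawSemiringDefinitions (Semiring.rawSemiring semiring) public
    using (_^_) renaming (_×_ to _·_; sum to ∑)

  infix 4 _<_ _≤_ ∣_-_∣≤_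

  field
    _<_                  : Rel Carrier 0ℓ
    isStrictPartialOrder : IsStrictPartialOrder _≈_ _<_

  _≤_ : Rel Carrier 0ℓ
  x ≤ y = ¬ (y < x)

  field
    cotransitive : ∀ {x y} → x < y → ∀ z → x < z ⊎ z < y
    antisym      : ∀ {x y} → x ≤ y → y ≤ x → x ≈ y
    0<1          : 0# < 1#
    +-monoˡ-<    : ∀ {x y} z → x < y → x + z < y + z
    *-pos        : ∀ {x y} → 0# < x → 0# < y → 0# < x * y
    inverse      : ∀ {x} → 0# < x → ∃[ y ] x * y ≈ 1#

  fromℕ : ℕ → Carrier
  fromℕ n = n · 1#

  ∣_-_∣≤_ : Carrier → Carrier → Carrier → Set
  ∣ x - y ∣≤ α = x - y ≤ α × y - x ≤ α

  ∑< : ℕ → (ℕ → Carrier) → Carrier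
  ∑< n f = ∑ {n} (f ∘ toℕ)

  infix 4 _⟶_

  _⟶_ : (ℕ → Carrier) → Carrier → Set
  s ⟶ l = ∀ {δ} → 0# < δ → ∃[ N ] (∀ n → N ℕ.≤ n → ∣ s n - l ∣≤ δ)

  IsCauchy : (ℕ → Carrier) → Set
  IsCauchy s = ∀ {δ} → 0# < δ →
    ∃[ N ] (∀ m n → N ℕ.≤ m → N ℕ.≤ n → ∣ s m - s n ∣≤ δ)

  -- y = e^x, as the sum of the series with terms a k = x ^ k / k !.

  IsExp : Carrier → Carrier → Set
  IsExp x y = ∃[ a ] ((∀ k → fromℕ (k !) * a k ≈ x ^ k) × (λ n → ∑< n a) ⟶ y)

-- These axioms hold for the Cauchy reals without excluded middle, and with it
-- they determine ℝ up to isomorphism.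

record RealField : Set₁ where
  field
    orderedField : OrderedField

  open OrderedField orderedField public

  field
    archimedean : ∀ x → ∃[ n ] x < fromℕ n
    complete    : ∀ s → IsCauchy s → ∃[ l ] s ⟶ l

module Randomized (ℝ : RealField) where

  open RealField ℝ public

  Point : ℕ → Set
  Point T = Fin T → Carrier

  -- Codes for the Borel subsets of ℝ^T, generated by open half-spaces.

  data Borel (T : ℕ) : Set where
    below above : Fin T → Carrier → Borel T
    ∅           : Borel T
    ∁           : Borel T → Borel T
    ⋃           : (ℕ → Borel T) → Borel T

  ⟦_⟧ : ∀ {T} → Borel T → Pred.Pred (Point T) 0ℓ
  ⟦ below t a ⟧ x = x t < a
  ⟦ above t a ⟧ x = a < x t
  ⟦ ∅         ⟧ x = ⊥
  ⟦ ∁ S       ⟧ x = ¬ ⟦ S ⟧ x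
  ⟦ ⋃ S       ⟧ x = ∃[ n ] ⟦ S n ⟧ x

  -- Monotonicity follows from additivity classically, but not without excluded
  -- middle. It makes the probability independent of the code chosen for a set.

  record ProbabilityMeasure (T : ℕ) : Set where
    field
      Pr            : Borel T → Carrier
      nonnegative   : ∀ S → 0# ≤ Pr S
      empty         : Pr ∅ ≈ 0#
      total         : Pr (∁ ∅) ≈ 1#
      monotone      : ∀ {S S′} → ⟦ S ⟧ Pred.⊆ ⟦ S′ ⟧ → Pr S ≤ Pr S′
      additive      : ∀ S → (∀ i j → i ≢ j → Pred.Empty (⟦ S i ⟧ Pred.∩ ⟦ S j ⟧)) →
                      (λ n → ∑< n (Pr ∘ S)) ⟶ Pr (⋃ S)

  open ProbabilityMeasure using (Pr)

  DeterminedUpTo : ∀ {T} → Fin T → Borel T → Set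
  DeterminedUpTo t S = ∀ x y → (∀ s → s Fin.≤ t → x s ≈ y s) → ⟦ S ⟧ x → ⟦ S ⟧ y

  -- By causality, outputs up to time t depend only on the insertions up to
  -- time t, and not on the lists chosen to represent them.

  record Algorithm (W T : ℕ) : Set where
    field
      law    : IncrementalSequence W T → ProbabilityMeasure T
      causal : ∀ t 𝒢 𝒢′ → AgreeUpTo t 𝒢 𝒢′ →
               ∀ S → DeterminedUpTo t S → Pr (law 𝒢) S ≈ Pr (law 𝒢′) S

    Pr[_]∈_ : IncrementalSequence W T → Borel T → Carrier
    Pr[ 𝒢 ]∈ S = Pr (law 𝒢) S

  IsNodePrivate : ∀ {W T} → Carrier → Algorithm W T → Set
  IsNodePrivate ε 𝒜 = ∃[ e^ε ] (IsExp ε e^ε ×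
    (∀ 𝒢 𝒢′ → NodeAdjacent 𝒢 𝒢′ → ∀ S → Pr[ 𝒢 ]∈ S ≤ e^ε * Pr[ 𝒢′ ]∈ S))
    where open Algorithm 𝒜

  Accurate : ∀ {W T} → Carrier → IncrementalSequence W T → Pred.Pred (Point T) 0ℓ
  Accurate α 𝒢 x =
    ∀ t m → IsMaxMatchingWeight (current 𝒢 t) m → ∣ x t - fromℕ m ∣≤ α

  -- The probability is that of all outputs being within α of the true values
  -- simultaneously. S is a code for this event.

  HasAdditiveError : ∀ {W T} → Carrier → Carrier → Algorithm W T → Set
  HasAdditiveError β α 𝒜 =
    ∀ 𝒢 → ∃[ S ] (⟦ S ⟧ Pred.≐ Accurate α 𝒢 × β ≤ Pr[ 𝒢 ]∈ S)
    where open Algorithm 𝒜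

-- A single time step may insert many nodes, so the packing argument needs no
-- blocks of time steps. Start from K isolated anchors; the j-th sequence attaches
-- at time j a leaf to every anchor by an edge of weight W, and inserts nothing at
-- other times. Its optimum jumps from 0 to K W at time j, so if 2 α < K W, then the
-- accurate outputs for different j form disjoint events. Removing the leaves one by
-- one leads in K adjacent steps to a sequence that does not depend on j; under it
-- each of the T disjoint events has probability at least β / e^(ε K). Hence
-- T β ≤ e^(ε K), which fails for K a small multiple of log T.

module Submission where

open import Defs
import Algebra.Properties.CommutativeSemigroup as CommutativeSemigroupProperties
import Algebra.Properties.Semiring.Mult as SemiringMult
import Algebra.Properties.Semiring.Sum as SemiringSum
open import Data.Empty using (⊥; ⊥-elim)
open import Data.Fin.Base as Fin using (Fin; zero; suc; toℕ)
import Data.Fin.Properties as Fin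
open import Data.List.Base using ([]; _∷_; _++_; applyDownFrom; downFrom)
open import Data.List.Membership.Propositional using (_∈_; _∉_)
open import Data.List.Membership.Propositional.Properties
  using (∈-∃++; ∈-++⁻; ∈-++⁺ˡ; ∈-++⁺ʳ;
         ∈-applyDownFrom⁺; ∈-applyDownFrom⁻; ∈-downFrom⁺; ∈-downFrom⁻)
open import Data.List.Relation.Binary.BagAndSetEquality using (_∼[_]_; set)
open import Data.List.Relation.Binary.Disjoint.Propositional using (Disjoint)
open import Data.List.Relation.Binary.Permutation.Propositional.Properties using (shift; map⁺)
open import Data.List.Relation.Binary.Subset.Propositional using (_⊆_)
open import Data.List.Relation.Unary.All as All using ([]; _∷_)
open import Data.List.Relation.Unary.AllPairs as AllPairs using (AllPairs; []; _∷_)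
import Data.List.Relation.Unary.AllPairs.Properties as AllPairs
open import Data.List.Relation.Unary.Any using (here; there)
open import Data.List.Relation.Unary.Unique.Propositional using (Unique)
open import Data.Nat.Base as ℕ using (ℕ; zero; suc; z≤n; s≤s; _!)
import Data.Nat.DivMod as ℕ
open import Data.Nat.Induction using (<-rec)
import Data.Nat.ListAction.Properties as List
open import Data.Nat.Logarithm using (⌊log₂_⌋; ⌊log₂⌋-mono-≤; ⌊log₂⌊n/2⌋⌋≡⌊log₂n⌋∸1; ⌊log₂[2^n]⌋≡n)
import Data.Nat.Properties as ℕ
open import Data.Nat.Solver using (module +-*-Solver)
open import Data.Product.Base using (_×_; _,_; ∃-syntax; proj₁; proj₂)
open import Data.Sum.Base using (_⊎_; inj₁; inj₂; [_,_]′)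
open import Function.Base using (_∘_; id; case_of_)
open import Function.Bundles using (_⇔_; mk⇔)
open import Function.Properties.Equivalence using (⇔-isEquivalence)
open import Level using (0ℓ)
open import Relation.Binary.Core using (Rel)
open import Relation.Binary.Definitions using (Transitive; Trans; tri<; tri≈; tri>)
open import Relation.Binary.PropositionalEquality as ≡ using (_≡_; _≢_)
import Relation.Binary.Reasoning.Base.Triple as Triple
open import Relation.Binary.Structures using (IsEquivalence; IsPreorder; IsStrictPartialOrder)
open import Relation.Nullary.Negation.Core using (¬_)
import Relation.Unary as Pred

module ⇔ {ℓ} = IsEquivalence (⇔-isEquivalence {ℓ})

-- Maximum matchings in graphs with pairwise disjoint edges

disjoint⇒unique : ∀ {M} → AllPairs VertexDisjoint M → Unique M
disjoint⇒unique = AllPairs.map λ { {e} e⊥e ≡.refl → e⊥e (lo e) (inj₁ ≡.refl , inj₁ ≡.refl) }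

-- List inclusion ignores multiplicities, so repetitions in `M` must be ruled out. Induction on `M`
-- deletes one occurrence of each of its elements from `N`.
totalWeight-mono : ∀ {M N} → Unique M → M ⊆ N → totalWeight M ℕ.≤ totalWeight N
totalWeight-mono {[]}    _          _   = z≤n
totalWeight-mono {e ∷ M} (e∉M ∷ uM) M⊆N with ∈-∃++ (M⊆N (here ≡.refl))
... | N₁ , N₂ , ≡.refl = begin
  weight e ℕ.+ totalWeight M           ≤⟨ ℕ.+-monoʳ-≤ (weight e) (totalWeight-mono uM M⊆N₁N₂) ⟩
  weight e ℕ.+ totalWeight (N₁ ++ N₂)  ≡⟨ List.sum-↭ (map⁺ weight (shift e N₁ N₂)) ⟨
  totalWeight (N₁ ++ e ∷ N₂)           ∎
  where
  open ℕ.≤-Reasoning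
  M⊆N₁N₂ : M ⊆ N₁ ++ N₂
  M⊆N₁N₂ f∈M with ∈-++⁻ N₁ (M⊆N (there f∈M))
  ... | inj₁ f∈N₁          = ∈-++⁺ˡ f∈N₁
  ... | inj₂ (here ≡.refl) = ⊥-elim (All.lookup e∉M f∈M ≡.refl)
  ... | inj₂ (there f∈N₂)  = ∈-++⁺ʳ N₁ f∈N₂

-- The edge list is then itself a matching, and any other matching is a repetition-free list
-- included in it.
matching-max : ∀ {G} → AllPairs VertexDisjoint (edges G) →
               IsMaxMatchingWeight G (totalWeight (edges G))
matching-max {G} disjoint =
  (edges G , (id , disjoint) , ≡.refl) ,
  λ M (M⊆ , M-disjoint) → totalWeight-mono (disjoint⇒unique M-disjoint) M⊆

-- Sequences that insert at one time only

none : Insertion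
none = insertion [] []

-- Recursion on both times, instead of a test for equality, keeps in step with `graphBefore`, so
-- facts about the current graph follow by simultaneous induction.
burst : ∀ {T} → Fin T → Insertion → Fin T → Insertion
burst zero    δ zero    = δ
burst zero    δ (suc t) = none
burst (suc j) δ zero    = none
burst (suc j) δ (suc t) = burst j δ t

burst-none : ∀ {T} (j t : Fin T) → burst j none t ≡ none
burst-none zero    zero    = ≡.refl
burst-none zero    (suc t) = ≡.refl
burst-none (suc j) zero    = ≡.refl
burst-none (suc j) (suc t) = burst-none j t

burst-now : ∀ {T} (j : Fin T) δ → burst j δ j ≡ δ
burst-now zero    δ = ≡.refl
burst-now (suc j) δ = burst-now j δ

burst-other : ∀ {T} (j : Fin T) δ t → t ≢ j → burst j δ t ≡ none
burst-other zero    δ zero    t≢j = ⊥-elim (t≢j ≡.refl)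
burst-other zero    δ (suc t) t≢j = ≡.refl
burst-other (suc j) δ zero    t≢j = ≡.refl
burst-other (suc j) δ (suc t) t≢j = burst-other j δ t (t≢j ∘ ≡.cong suc)

burst-preserves : ∀ {T} {R : Rel Insertion 0ℓ} {δ δ′} → R none none → R δ δ′ →
                  ∀ (j t : Fin T) → R (burst j δ t) (burst j δ′ t)
burst-preserves idle now zero    zero    = now
burst-preserves idle now zero    (suc t) = idle
burst-preserves idle now (suc j) zero    = idle
burst-preserves {R = R} idle now (suc j) (suc t) = burst-preserves {R = R} idle now j t

graphBefore-idle : ∀ {T} G (t : Fin T) → graphBefore G (λ _ → none) t ≡ G
graphBefore-idle G zero    = ≡.refl
graphBefore-idle G (suc t) = graphBefore-idle G t

-- Indexing by the graph before a step and by the insertion lets one case split determine both, so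
-- each condition on a burst sequence has only three cases.
data Phase (G : Graph) (δ : Insertion) : Graph → Insertion → Set where
  early : Phase G δ G none
  now   : Phase G δ G δ
  late  : Phase G δ (insert G δ) none

phase : ∀ {T} G δ (j t : Fin T) → Phase G δ (graphBefore G (burst j δ) t) (burst j δ t)
phase G δ zero    zero    = now
phase G δ zero    (suc t) =
  ≡.subst (λ H → Phase G δ H none) (≡.sym (graphBefore-idle (insert G δ) t)) late
phase G δ (suc j) zero    = early
phase G δ (suc j) (suc t) = phase G δ j t

graphAfter-early : ∀ {T} G δ {j t : Fin T} → t Fin.< j → graphAfter G (burst j δ) t ≡ G
graphAfter-early G δ {suc j} {zero}  _         = ≡.refl
graphAfter-early G δ {suc j} {suc t} (s≤s t<j) = graphAfter-early G δ t<j

graphAfter-now : ∀ {T} G δ (j : Fin T) → graphAfter G (burst j δ) j ≡ insert G δ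
graphAfter-now G δ zero    = ≡.refl
graphAfter-now G δ (suc j) = graphAfter-now G δ j

burstSequence : ∀ {W T G δ} → IsWeightedGraph W G → IsWeightedGraph W (insert G δ) →
                Disjoint (∂V δ) (nodes G) → Disjoint (∂E δ) (edges G) →
                Fin T → IncrementalSequence W T
burstSequence {W} {T} {G} {δ} G-ok G+δ-ok ∂V-fresh ∂E-fresh j = record
  { initial     = G
  ; insertions  = burst j δ
  ; initial-ok  = G-ok
  ; fresh-nodes = λ t → nodes-ok (phase G δ j t)
  ; fresh-edges = λ t → edges-ok (phase G δ j t)
  ; after-ok    = λ t → after (phase G δ j t)
  }
  where
  nodes-ok : ∀ {H η} → Phase G δ H η → Disjoint (∂V η) (nodes H)
  nodes-ok early = λ ()
  nodes-ok now   = ∂V-fresh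
  nodes-ok late  = λ ()
  edges-ok : ∀ {H η} → Phase G δ H η → Disjoint (∂E η) (edges H)
  edges-ok early = λ ()
  edges-ok now   = ∂E-fresh
  edges-ok late  = λ ()
  after : ∀ {H η} → Phase G δ H η → IsWeightedGraph W (insert H η)
  -- Inserting `none` leaves a graph definitionally unchanged.
  after early = G-ok
  after now   = G+δ-ok
  after late  = G+δ-ok

-- The hard instances: pendant edges at anchors

module Pendants (W K : ℕ) (1≤W : 1 ℕ.≤ W) where

  -- Anchors are the numbers below `K`, and leaves lie above `K`. The `suc` yields `i < leaf i` for
  -- every `K`, as the ordered endpoints of `pendant i` demand.
  leaf : ℕ → Node
  leaf i = suc (K ℕ.+ i)

  leaf-injective : ∀ {i j} → leaf i ≡ leaf j → i ≡ j
  leaf-injective = ℕ.+-cancelˡ-≡ K _ _ ∘ ℕ.suc-injective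

  anchor≢leaf : ∀ {i j} → i ℕ.< K → i ≢ leaf j
  anchor≢leaf {i} {j} i<K = ℕ.<⇒≢ (ℕ.m<n⇒m<1+n (ℕ.<-≤-trans i<K (ℕ.m≤m+n K j)))

  pendant : ℕ → Edge
  pendant i = edge i (leaf i) (s≤s (ℕ.m≤n+m i K)) W

  anchors : Graph
  anchors = graph (downFrom K) []

  -- The lists run downwards so that `growth (suc l)` is `growth l` with `leaf l` and `pendant l` in
  -- front: omitting one node undoes exactly one step.
  growth : ℕ → Insertion
  growth l = insertion (applyDownFrom leaf l) (applyDownFrom pendant l)

  -- The trailing `[]` is the edge list of `anchors`, left there by `insert`.
  ∈-pendants : ∀ {l e} → e ∈ applyDownFrom pendant l ++ [] →
               ∃[ i ] (i ℕ.< l × e ≡ pendant i)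
  ∈-pendants {l} e∈ with ∈-++⁻ (applyDownFrom pendant l) e∈
  ... | inj₁ e∈′ = ∈-applyDownFrom⁻ pendant e∈′

  anchors-ok : IsWeightedGraph W anchors
  anchors-ok = record { endpoints = λ () ; simple = λ () ; weights = λ () }

  growth-ok : ∀ {l} → l ℕ.≤ K → IsWeightedGraph W (insert anchors (growth l))
  growth-ok {l} l≤K = record { endpoints = ends ; simple = same ; weights = bounds }
    where
    ends : ∀ {e} → e ∈ applyDownFrom pendant l ++ [] →
           lo e ∈ applyDownFrom leaf l ++ downFrom K × hi e ∈ applyDownFrom leaf l ++ downFrom K
    ends e∈ with ∈-pendants {l} e∈
    ... | i , i<l , ≡.refl = ∈-++⁺ʳ _ (∈-downFrom⁺ (ℕ.<-≤-trans i<l l≤K)) ,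
                             ∈-++⁺ˡ (∈-applyDownFrom⁺ leaf i<l)
    same : ∀ {e f} → e ∈ applyDownFrom pendant l ++ [] → f ∈ applyDownFrom pendant l ++ [] →
           lo e ≡ lo f → hi e ≡ hi f → weight e ≡ weight f
    same e∈ f∈ _ _ with ∈-pendants {l} e∈ | ∈-pendants {l} f∈
    ... | _ , _ , ≡.refl | _ , _ , ≡.refl = ≡.refl
    bounds : ∀ {e} → e ∈ applyDownFrom pendant l ++ [] → 1 ℕ.≤ weight e × weight e ℕ.≤ W
    bounds e∈ with ∈-pendants {l} e∈
    ... | _ , _ , ≡.refl = 1≤W , ℕ.≤-refl

  growth-fresh : ∀ l → Disjoint (∂V (growth l)) (nodes anchors)
  growth-fresh l (v∈leaves , v∈anchors) with ∈-applyDownFrom⁻ leaf {n = l} v∈leaves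
  ... | _ , _ , v≡leaf = anchor≢leaf (∈-downFrom⁻ v∈anchors) v≡leaf

  pendantSequence : ∀ {T} → Fin T → (l : ℕ) → l ℕ.≤ K → IncrementalSequence W T
  pendantSequence j l l≤K =
    burstSequence {δ = growth l} anchors-ok (growth-ok l≤K) (growth-fresh l) (λ ()) j

  -- Distinct pendant edges share neither anchor nor leaf, so all `l` of them together form the
  -- optimal matching.
  growth-max : ∀ {l} → l ℕ.≤ K → IsMaxMatchingWeight (insert anchors (growth l)) (l ℕ.* W)
  growth-max {l} l≤K = ≡.subst (IsMaxMatchingWeight G) (total l)
    (matching-max {G} (AllPairs.++⁺ (AllPairs.applyDownFrom⁺₁ pendant l apart) []
                                    (All.universal (λ _ → []) _)))
    where
    G = insert anchors (growth l)
    apart : ∀ {i j} → j ℕ.< i → i ℕ.< l → VertexDisjoint (pendant i) (pendant j)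
    apart j<i i<l v (inj₁ ≡.refl , inj₁ ≡.refl) = ℕ.<-irrefl ≡.refl j<i
    apart j<i i<l v (inj₁ ≡.refl , inj₂ eq)     = anchor≢leaf (ℕ.<-≤-trans i<l l≤K) eq
    apart j<i i<l v (inj₂ ≡.refl , inj₁ eq)     =
      anchor≢leaf (ℕ.<-≤-trans (ℕ.<-trans j<i i<l) l≤K) (≡.sym eq)
    apart j<i i<l v (inj₂ ≡.refl , inj₂ eq)     = ℕ.<⇒≢ j<i (leaf-injective (≡.sym eq))
    total : ∀ l → totalWeight (applyDownFrom pendant l ++ []) ≡ l ℕ.* W
    total zero    = ≡.refl
    total (suc l) = ≡.cong (W ℕ.+_) (total l)

  -- 𝒢 need only agree pointwise with the smaller burst: a burst of nothing at time j
  -- must be interchangeable with one at another time.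
  adjacent : ∀ {T} (j : Fin T) {l} (l<K : l ℕ.< K) (𝒢 : IncrementalSequence W T) →
             initial 𝒢 ≡ anchors → (∀ t → insertions 𝒢 t ≡ burst j (growth l) t) →
             NodeAdjacent (pendantSequence j (suc l) l<K) 𝒢
  adjacent {T} j {l} l<K 𝒢 ≡.refl 𝒢≗ = inj₁ (record
    { same-initial = ⇔.refl , ⇔.refl
    ; v*           = leaf l
    ; t*           = j
    ; other-times  = other
    ; subset       = sub
    ; difference   = diff
    -- A unary property enters `burst-preserves` as a relation constant in its second argument, so
    -- any insertion serves as `δ′`.
    ; incident     = λ t → burst-preserves {R = λ δ _ → Covered δ} {δ′ = none} (λ ()) covered j t
    ; edges-kept   = λ t e → kept t e
    })
    where
    Covered : Insertion → Set
    Covered δ = ∀ {e} → e ∈ ∂E δ → ∃[ v ] (v ∈ ∂V δ × Incident v e)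
    covered : Covered (growth (suc l))
    covered e∈ with ∈-applyDownFrom⁻ pendant {n = suc l} e∈
    ... | i , i≤l , ≡.refl = leaf i , ∈-applyDownFrom⁺ leaf i≤l , inj₂ ≡.refl

    other : ∀ t → t ≢ j → ∂V (burst j (growth (suc l)) t) ∼[ set ] ∂V (insertions 𝒢 t)
    other t t≢j rewrite 𝒢≗ t | burst-other j (growth (suc l)) t t≢j
                      | burst-other j (growth l) t t≢j = ⇔.refl

    sub : ∂V (insertions 𝒢 j) ⊆ ∂V (burst j (growth (suc l)) j)
    sub rewrite 𝒢≗ j | burst-now j (growth (suc l)) | burst-now j (growth l) = there

    diff : ∀ v → (v ∈ ∂V (burst j (growth (suc l)) j) × v ∉ ∂V (insertions 𝒢 j)) ⇔ v ≡ leaf l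
    diff v rewrite 𝒢≗ j | burst-now j (growth (suc l)) | burst-now j (growth l) =
      mk⇔ (λ { (here eq , _) → eq ; (there v∈ , v∉) → ⊥-elim (v∉ v∈) })
          (λ { ≡.refl → here ≡.refl , λ v∈ → case ∈-applyDownFrom⁻ leaf {n = l} v∈ of
                 λ (i , i<l , eq) → ℕ.<⇒≢ i<l (leaf-injective (≡.sym eq)) })

    Kept : Rel Insertion 0ℓ
    Kept δ δ′ = ∀ e → e ∈ ∂E δ′ ⇔ (e ∈ ∂E δ × ¬ Incident (leaf l) e)
    kept : ∀ t → Kept (burst j (growth (suc l)) t) (insertions 𝒢 t)
    kept t rewrite 𝒢≗ t = burst-preserves {R = Kept} (λ e → mk⇔ (λ ()) (λ ())) now′ j t
      where
      now′ : Kept (growth (suc l)) (growth l)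
      now′ e = mk⇔ to from
        where
        to : e ∈ ∂E (growth l) → e ∈ ∂E (growth (suc l)) × ¬ Incident (leaf l) e
        to e∈ with ∈-applyDownFrom⁻ pendant {n = l} e∈
        ... | i , i<l , ≡.refl = there e∈ , λ where
          (inj₁ eq) → anchor≢leaf (ℕ.<-trans i<l l<K) (≡.sym eq)
          (inj₂ eq) → ℕ.<⇒≢ i<l (leaf-injective (≡.sym eq))
        from : e ∈ ∂E (growth (suc l)) × ¬ Incident (leaf l) e → e ∈ applyDownFrom pendant l
        from (here ≡.refl , ¬inc) = ⊥-elim (¬inc (inj₂ ≡.refl))
        from (there e∈ , _)       = e∈

-- Natural-number estimates for the exponential series

n≤2^n : ∀ n → n ℕ.≤ 2 ℕ.^ n
n≤2^n zero    = z≤n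
n≤2^n (suc n) = begin
  1 ℕ.+ n                    ≤⟨ ℕ.+-mono-≤ (ℕ.m^n>0 2 n) (n≤2^n n) ⟩
  2 ℕ.^ n ℕ.+ 2 ℕ.^ n        ≡⟨ ≡.cong (2 ℕ.^ n ℕ.+_) (ℕ.+-identityʳ _) ⟨
  2 ℕ.^ suc n                ∎
  where open ℕ.≤-Reasoning

^-distrib-* : ∀ m n k → (m ℕ.* n) ℕ.^ k ≡ m ℕ.^ k ℕ.* n ℕ.^ k
^-distrib-* m n zero    = ≡.refl
^-distrib-* m n (suc k) = ≡.trans (≡.cong (m ℕ.* n ℕ.*_) (^-distrib-* m n k))
                                  (ℕ.[m*n]*[o*p]≡[m*o]*[n*p] m n (m ℕ.^ k) (n ℕ.^ k))

-- Up to exponent `n` the factor `n ^ n` suffices. Beyond it, each step multiplies the left side by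
-- `n` and the right side by `suc k`, which is at least `n`.
^≤^*! : ∀ n .{{_ : ℕ.NonZero n}} k → n ℕ.^ k ℕ.≤ n ℕ.^ n ℕ.* k !
^≤^*! n zero = ≡.subst (1 ℕ.≤_) (≡.sym (ℕ.*-identityʳ (n ℕ.^ n))) (ℕ.m^n>0 n n)
^≤^*! n (suc k) with ℕ.≤-total (suc k) n
... | inj₁ k<n = begin
  n ℕ.^ suc k            ≤⟨ ℕ.^-monoʳ-≤ n k<n ⟩
  n ℕ.^ n                ≤⟨ ℕ.m≤m*n (n ℕ.^ n) (suc k !) {{suc k ℕ.!≢0}} ⟩
  n ℕ.^ n ℕ.* suc k !    ∎
  where open ℕ.≤-Reasoning
... | inj₂ n≤1+k = begin
  n ℕ.* n ℕ.^ k                    ≤⟨ ℕ.*-mono-≤ n≤1+k (^≤^*! n k) ⟩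
  suc k ℕ.* (n ℕ.^ n ℕ.* k !)      ≡⟨ ℕ.*-assoc (suc k) (n ℕ.^ n) (k !) ⟨
  suc k ℕ.* n ℕ.^ n ℕ.* k !        ≡⟨ ≡.cong (ℕ._* k !) (ℕ.*-comm (suc k) (n ℕ.^ n)) ⟩
  n ℕ.^ n ℕ.* suc k ℕ.* k !        ≡⟨ ℕ.*-assoc (n ℕ.^ n) (suc k) (k !) ⟩
  n ℕ.^ n ℕ.* suc k !              ∎
  where open ℕ.≤-Reasoning

-- By ^≤^*!, x ^ k / k ! ≤ (2m) ^ (2m) / 2 ^ k for x ≤ m; sum over k.
expBound : ℕ → ℕ
expBound m = 2m ℕ.^ 2m ℕ.+ 2m ℕ.^ 2m
  where 2m = 2 ℕ.* m

expBound-nonZero : ∀ m .{{_ : ℕ.NonZero m}} → ℕ.NonZero (expBound m)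
expBound-nonZero m =
  ℕ.>-nonZero (ℕ.<-≤-trans (ℕ.m^n>0 2m {{ℕ.m*n≢0 2 m}} 2m) (ℕ.m≤m+n (2m ℕ.^ 2m) (2m ℕ.^ 2m)))
  where 2m = 2 ℕ.* m

-- Ordered fields without a decidable order

module OrderedFieldProperties (𝔽 : OrderedField) where

  open OrderedField 𝔽 hiding (zero)
  private
    module < = IsStrictPartialOrder isStrictPartialOrder
    module Mult = SemiringMult semiring
  open CommutativeSemigroupProperties *-commutativeSemigroup using ()
    renaming (x∙yz≈y∙xz to *-swap)

  -- As `x ≤ y` abbreviates `¬ (y < x)`, this and the two mixed laws below split a strict inequality
  -- at the third point by `cotransitive`.
  ≤-trans : Transitive _≤_
  ≤-trans {_} {y} x≤y y≤z z<x = [ y≤z , x≤y ]′ (cotransitive z<x y)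

  <-≤-trans : Trans _<_ _≤_ _<_
  <-≤-trans {_} {_} {z} x<y y≤z = [ id , ⊥-elim ∘ y≤z ]′ (cotransitive x<y z)

  ≤-<-trans : Trans _≤_ _<_ _<_
  ≤-<-trans {x} x≤y y<z = [ ⊥-elim ∘ x≤y , id ]′ (cotransitive y<z x)

  <⇒≤ : ∀ {x y} → x < y → x ≤ y
  <⇒≤ = <.asym

  ≤-isPreorder : IsPreorder _≈_ _≤_
  ≤-isPreorder = record
    { isEquivalence = isEquivalence
    ; reflexive     = λ x≈y → <.irrefl (sym x≈y)
    ; trans         = ≤-trans
    }

  module ≤-Reasoning = Triple ≤-isPreorder <.asym <.trans <.<-resp-≈ <⇒≤ <-≤-trans ≤-<-trans

  open ≤-Reasoning

  ≤-refl : ∀ {x} → x ≤ x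
  ≤-refl = <.irrefl refl

  x+z-z≈x : ∀ x z → (x + z) - z ≈ x
  x+z-z≈x x z = trans (+-assoc x z (- z)) (trans (+-congˡ (-‿inverseʳ z)) (+-identityʳ x))

  x-z+z≈x : ∀ x z → (x - z) + z ≈ x
  x-z+z≈x x z = trans (+-assoc x (- z) z) (trans (+-congˡ (-‿inverseˡ z)) (+-identityʳ x))

  +-cancelʳ-< : ∀ {x y} z → x + z < y + z → x < y
  +-cancelʳ-< {x} {y} z x+z<y+z = begin-strict
    x            ≈⟨ x+z-z≈x x z ⟨
    (x + z) - z  <⟨ +-monoˡ-< (- z) x+z<y+z ⟩
    (y + z) - z  ≈⟨ x+z-z≈x y z ⟩
    y            ∎

  +-monoˡ-≤ : ∀ {x y} z → x ≤ y → x + z ≤ y + z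
  +-monoˡ-≤ z x≤y = x≤y ∘ +-cancelʳ-< z

  +-monoʳ-< : ∀ {x y} z → x < y → z + x < z + y
  +-monoʳ-< {x} {y} z x<y = begin-strict
    z + x  ≈⟨ +-comm z x ⟩
    x + z  <⟨ +-monoˡ-< z x<y ⟩
    y + z  ≈⟨ +-comm y z ⟩
    z + y  ∎

  +-cancelˡ-< : ∀ {x y} z → z + x < z + y → x < y
  +-cancelˡ-< {x} {y} z p = +-cancelʳ-< z (begin-strict
    x + z  ≈⟨ +-comm x z ⟩
    z + x  <⟨ p ⟩
    z + y  ≈⟨ +-comm z y ⟩
    y + z  ∎)

  +-monoʳ-≤ : ∀ {x y} z → x ≤ y → z + x ≤ z + y
  +-monoʳ-≤ z x≤y = x≤y ∘ +-cancelˡ-< z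

  +-mono-≤ : ∀ {x y u v} → x ≤ y → u ≤ v → x + u ≤ y + v
  +-mono-≤ {y = y} {u} x≤y u≤v = ≤-trans (+-monoˡ-≤ u x≤y) (+-monoʳ-≤ y u≤v)

  +-mono-< : ∀ {x y u v} → x < y → u < v → x + u < y + v
  +-mono-< {y = y} {u} x<y u<v = <.trans (+-monoˡ-< u x<y) (+-monoʳ-< y u<v)

  x<x+y : ∀ x {y} → 0# < y → x < x + y
  x<x+y x {y} 0<y = begin-strict
    x       ≈⟨ +-identityʳ x ⟨
    x + 0#  <⟨ +-monoʳ-< x 0<y ⟩
    x + y   ∎

  x≤x+y : ∀ x {y} → 0# ≤ y → x ≤ x + y
  x≤x+y x {y} 0≤y = begin
    x       ≈⟨ +-identityʳ x ⟨
    x + 0#  ≤⟨ +-monoʳ-≤ x 0≤y ⟩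
    x + y   ∎

  x<y⇒0<y-x : ∀ {x y} → x < y → 0# < y - x
  x<y⇒0<y-x {x} {y} x<y = begin-strict
    0#     ≈⟨ -‿inverseʳ x ⟨
    x - x  <⟨ +-monoˡ-< (- x) x<y ⟩
    y - x  ∎

  x≤y⇒0≤y-x : ∀ {x y} → x ≤ y → 0# ≤ y - x
  x≤y⇒0≤y-x {x} {y} x≤y = begin
    0#     ≈⟨ -‿inverseʳ x ⟨
    x - x  ≤⟨ +-monoˡ-≤ (- x) x≤y ⟩
    y - x  ∎

  +-pos : ∀ {x y} → 0# < x → 0# ≤ y → 0# < x + y
  +-pos {x} {y} 0<x 0≤y = <-≤-trans 0<x (x≤x+y x 0≤y)

  +-nonneg : ∀ {x y} → 0# ≤ x → 0# ≤ y → 0# ≤ x + y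
  +-nonneg {x} 0≤x 0≤y = ≤-trans 0≤x (x≤x+y x 0≤y)

  0<x+y⇒0<x⊎0<y : ∀ {x y} → 0# < x + y → 0# < x ⊎ 0# < y
  0<x+y⇒0<x⊎0<y {x} {y} 0<x+y with cotransitive 0<x+y x
  ... | inj₁ 0<x   = inj₁ 0<x
  ... | inj₂ x<x+y = inj₂ (+-cancelˡ-< x (≤-<-trans (<.irrefl (sym (+-identityʳ x))) x<x+y))

  -- The sign of x is undecidable; antisym replaces the case distinction, since a
  -- negative product rules out both x ≤ 0 and y ≤ 0.
  *-nonneg : ∀ {x y} → 0# ≤ x → 0# ≤ y → 0# ≤ x * y
  *-nonneg {x} {y} 0≤x 0≤y xy<0 = ¬x≤0 λ 0<x → ¬y≤0 λ 0<y → <.asym xy<0 (*-pos 0<x 0<y)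
    where
    ¬x≤0 : ¬ (x ≤ 0#)
    ¬x≤0 x≤0 = <.irrefl (trans (*-congʳ (antisym x≤0 0≤x)) (zeroˡ y)) xy<0
    ¬y≤0 : ¬ (y ≤ 0#)
    ¬y≤0 y≤0 = <.irrefl (trans (*-congˡ (antisym y≤0 0≤y)) (zeroʳ x)) xy<0

  y≈x+[y-x] : ∀ x y → y ≈ x + (y - x)
  y≈x+[y-x] x y = trans (sym (x-z+z≈x y x)) (+-comm (y - x) x)

  *-monoʳ-< : ∀ {x y z} → 0# < z → x < y → z * x < z * y
  *-monoʳ-< {x} {y} {z} 0<z x<y = begin-strict
    z * x                <⟨ x<x+y (z * x) (*-pos 0<z (x<y⇒0<y-x x<y)) ⟩
    z * x + z * (y - x)  ≈⟨ distribˡ z x (y - x) ⟨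
    z * (x + (y - x))    ≈⟨ *-congˡ (y≈x+[y-x] x y) ⟨
    z * y                ∎

  *-monoʳ-≤ : ∀ {x y z} → 0# ≤ z → x ≤ y → z * x ≤ z * y
  *-monoʳ-≤ {x} {y} {z} 0≤z x≤y = begin
    z * x                ≤⟨ x≤x+y (z * x) (*-nonneg 0≤z (x≤y⇒0≤y-x x≤y)) ⟩
    z * x + z * (y - x)  ≈⟨ distribˡ z x (y - x) ⟨
    z * (x + (y - x))    ≈⟨ *-congˡ (y≈x+[y-x] x y) ⟨
    z * y                ∎

  *-monoˡ-≤ : ∀ {x y z} → 0# ≤ z → x ≤ y → x * z ≤ y * z
  *-monoˡ-≤ {x} {y} {z} 0≤z x≤y = begin
    x * z  ≈⟨ *-comm x z ⟩
    z * x  ≤⟨ *-monoʳ-≤ 0≤z x≤y ⟩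
    z * y  ≈⟨ *-comm z y ⟩
    y * z  ∎

  *-cancelˡ-≤ : ∀ {x y z} → 0# < z → z * x ≤ z * y → x ≤ y
  *-cancelˡ-≤ 0<z zx≤zy y<x = zx≤zy (*-monoʳ-< 0<z y<x)

  fromℕ-+ : ∀ m n → fromℕ (m ℕ.+ n) ≈ fromℕ m + fromℕ n
  fromℕ-+ = Mult.×-homo-+ 1#

  fromℕ-* : ∀ m n → fromℕ (m ℕ.* n) ≈ fromℕ m * fromℕ n
  fromℕ-* = Mult.×1-homo-*

  fromℕ-*-· : ∀ n x → fromℕ n * x ≈ n · x
  fromℕ-*-· n x = trans (Mult.×-assoc-* n 1# x) (Mult.×-congʳ n (*-identityˡ x))

  fromℕ-nonneg : ∀ n → 0# ≤ fromℕ n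
  fromℕ-nonneg zero    = ≤-refl
  fromℕ-nonneg (suc n) = +-nonneg (<⇒≤ 0<1) (fromℕ-nonneg n)

  fromℕ-pos : ∀ n .{{_ : ℕ.NonZero n}} → 0# < fromℕ n
  fromℕ-pos (suc n) = +-pos 0<1 (fromℕ-nonneg n)

  fromℕ-mono-≤ : ∀ {m n} → m ℕ.≤ n → fromℕ m ≤ fromℕ n
  fromℕ-mono-≤ {n = n} z≤n = fromℕ-nonneg n
  fromℕ-mono-≤ (s≤s m≤n) = +-monoʳ-≤ 1# (fromℕ-mono-≤ m≤n)

  0<n·x⇒0<x : ∀ n {x} → 0# < n · x → 0# < x
  0<n·x⇒0<x zero    0<0   = ⊥-elim (≤-refl 0<0)
  0<n·x⇒0<x (suc n) 0<x+nx = [ id , 0<n·x⇒0<x n ]′ (0<x+y⇒0<x⊎0<y 0<x+nx)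

  -- The axiom `inverse` is silent on the sign. Since `n` copies of `x` add up to `1#`, which is
  -- positive, `x` is positive.
  reciprocal : ∀ n .{{_ : ℕ.NonZero n}} → ∃[ x ] (0# < x × fromℕ n * x ≈ 1#)
  reciprocal n with inverse (fromℕ-pos n)
  ... | x , nx≈1 = x , 0<n·x⇒0<x n (begin-strict
    0#           <⟨ 0<1 ⟩
    1#           ≈⟨ nx≈1 ⟨
    fromℕ n * x  ≈⟨ fromℕ-*-· n x ⟩
    n · x        ∎) , nx≈1

  -- Limits, finite sums and a bound on the exponential

  smaller : ∀ {x} → 0# < x → ∃[ y ] (0# < y × y < x)
  smaller {x} 0<x = h * x , 0<hx , (begin-strict
    h * x                <⟨ x<x+y (h * x) 0<hx ⟩
    h * x + h * x        ≈⟨ distribʳ x h h ⟨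
    (h + h) * x          ≈⟨ *-congʳ (+-congˡ (+-identityʳ h)) ⟨
    (2 · h) * x          ≈⟨ *-congʳ (fromℕ-*-· 2 h) ⟨
    fromℕ 2 * h * x      ≈⟨ *-congʳ (proj₂ (proj₂ (reciprocal 2))) ⟩
    1# * x               ≈⟨ *-identityˡ x ⟩
    x                    ∎)
    where
    h = proj₁ (reciprocal 2)
    0<hx : 0# < h * x
    0<hx = *-pos (proj₁ (proj₂ (reciprocal 2))) 0<x

  -- Convergence promises only non-strict closeness. A tolerance strictly below `d` makes it strict,
  -- as refuting a `≤` requires.
  ⟶⇒eventually-< : ∀ {s l d} → s ⟶ l → 0# < d →
                   ∃[ N ] (∀ n → N ℕ.≤ n → s n - l < d × l - s n < d)
  ⟶⇒eventually-< s⟶l 0<d =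
    let δ , 0<δ , δ<d = smaller 0<d
        N , close     = s⟶l 0<δ
    in N , λ n N≤n → ≤-<-trans (proj₁ (close n N≤n)) δ<d , ≤-<-trans (proj₂ (close n N≤n)) δ<d

  ⟶-lower : ∀ {s l x} m → s ⟶ l → (∀ n → m ℕ.≤ n → x ≤ s n) → x ≤ l
  ⟶-lower {l = l} m s⟶l x≤s l<x =
    let N , close = ⟶⇒eventually-< s⟶l (x<y⇒0<y-x l<x)
    in x≤s (m ℕ.⊔ N) (ℕ.m≤m⊔n m N) (+-cancelʳ-< (- l) (proj₁ (close (m ℕ.⊔ N) (ℕ.m≤n⊔m m N))))

  -‿cancelˡ-< : ∀ {x y} z → z - x < z - y → y < x
  -‿cancelˡ-< {x} {y} z z-x<z-y = begin-strict
    y                ≈⟨ x-z+z≈x y x ⟨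
    y - x + x        ≈⟨ +-congʳ (+-comm y (- x)) ⟩
    - x + y + x      <⟨ +-monoˡ-< x (+-monoˡ-< y (+-cancelˡ-< z z-x<z-y)) ⟩
    - y + y + x      ≈⟨ +-congʳ (-‿inverseˡ y) ⟩
    0# + x           ≈⟨ +-identityˡ x ⟩
    x                ∎

  ⟶-upper : ∀ {s l x} → s ⟶ l → (∀ n → s n ≤ x) → l ≤ x
  ⟶-upper {l = l} s⟶l s≤x x<l =
    let N , close = ⟶⇒eventually-< s⟶l (x<y⇒0<y-x x<l)
    in s≤x N (-‿cancelˡ-< l (proj₂ (close N ℕ.≤-refl)))

  ∑<-nonneg : ∀ n {f} → (∀ k → 0# ≤ f k) → 0# ≤ ∑< n f
  ∑<-nonneg zero    0≤f = ≤-refl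
  ∑<-nonneg (suc n) 0≤f = +-nonneg (0≤f 0) (∑<-nonneg n (0≤f ∘ suc))

  ∑<-mono-≤ : ∀ {m n f} → (∀ k → 0# ≤ f k) → m ℕ.≤ n → ∑< m f ≤ ∑< n f
  ∑<-mono-≤ {n = n} 0≤f z≤n = ∑<-nonneg n 0≤f
  ∑<-mono-≤ {f = f} 0≤f (s≤s m≤n) = +-monoʳ-≤ (f 0) (∑<-mono-≤ (0≤f ∘ suc) m≤n)

  ∑-lower : ∀ {n x b} (f : Fin n → Carrier) → (∀ i → x ≤ b * f i) → fromℕ n * x ≤ b * ∑ f
  ∑-lower {zero}  {x} {b} f x≤bf = <.irrefl (trans (zeroʳ b) (sym (zeroˡ x)))
  ∑-lower {suc n} {x} {b} f x≤bf = begin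
    (1# + fromℕ n) * x              ≈⟨ distribʳ x 1# (fromℕ n) ⟩
    1# * x + fromℕ n * x            ≈⟨ +-congʳ (*-identityˡ x) ⟩
    x + fromℕ n * x                 ≤⟨ +-mono-≤ (x≤bf zero) (∑-lower (f ∘ suc) (x≤bf ∘ suc)) ⟩
    b * f zero + b * ∑ (f ∘ suc)    ≈⟨ distribˡ b _ _ ⟨
    b * (f zero + ∑ (f ∘ suc))      ∎

  x+x≤y+y⇒x≤y : ∀ {x y} → x + x ≤ y + y → x ≤ y
  x+x≤y+y⇒x≤y 2x≤2y y<x = 2x≤2y (+-mono-< y<x y<x)

  -- The terms are at most `D / 2 ^ k`. To avoid division, the induction doubles the tail: the
  -- doubled tail meets the same hypothesis with the same `D`, so it sums to at most `D + D`, and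
  -- the tail itself to at most `D`.
  ∑<-geometric : ∀ n {f D} → 0# ≤ D → (∀ k → fromℕ (2 ℕ.^ k) * f k ≤ D) → ∑< n f ≤ D + D
  ∑<-geometric zero    0≤D f≤ = +-nonneg 0≤D 0≤D
  ∑<-geometric (suc n) {f} {D} 0≤D f≤ = +-mono-≤ head≤D (x+x≤y+y⇒x≤y (begin
    ∑< n (f ∘ suc) + ∑< n (f ∘ suc)      ≈⟨ SemiringSum.∑-distrib-+ semiring {n} (f ∘ suc ∘ toℕ) (f ∘ suc ∘ toℕ) ⟨
    ∑< n (λ k → f (suc k) + f (suc k))   ≤⟨ ∑<-geometric n 0≤D tail≤D ⟩
    D + D                                ∎))
    where
    head≤D : f 0 ≤ D
    head≤D = begin
      f 0              ≈⟨ *-identityˡ (f 0) ⟨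
      1# * f 0         ≈⟨ *-congʳ (+-identityʳ 1#) ⟨
      fromℕ 1 * f 0    ≤⟨ f≤ 0 ⟩
      D                ∎
    tail≤D : ∀ k → fromℕ (2 ℕ.^ k) * (f (suc k) + f (suc k)) ≤ D
    tail≤D k = begin
      fromℕ (2 ℕ.^ k) * (f (suc k) + f (suc k))   ≈⟨ *-congˡ (+-congˡ (+-identityʳ _)) ⟨
      fromℕ (2 ℕ.^ k) * (2 · f (suc k))           ≈⟨ *-congˡ (fromℕ-*-· 2 (f (suc k))) ⟨
      fromℕ (2 ℕ.^ k) * (fromℕ 2 * f (suc k))     ≈⟨ *-swap _ _ _ ⟩
      fromℕ 2 * (fromℕ (2 ℕ.^ k) * f (suc k))     ≈⟨ *-assoc _ _ _ ⟨
      fromℕ 2 * fromℕ (2 ℕ.^ k) * f (suc k)       ≈⟨ *-congʳ (fromℕ-* 2 (2 ℕ.^ k)) ⟨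
      fromℕ (2 ℕ.^ suc k) * f (suc k)             ≤⟨ f≤ (suc k) ⟩
      D                                           ∎

  ^-≤-fromℕ : ∀ {x m} → 0# ≤ x → x ≤ fromℕ m → ∀ k → x ^ k ≤ fromℕ (m ℕ.^ k)
  ^-≤-fromℕ 0≤x x≤m zero = <.irrefl (+-identityʳ 1#)
  ^-≤-fromℕ {x} {m} 0≤x x≤m (suc k) = begin
    x * x ^ k                     ≤⟨ *-monoʳ-≤ 0≤x (^-≤-fromℕ 0≤x x≤m k) ⟩
    x * fromℕ (m ℕ.^ k)           ≤⟨ *-monoˡ-≤ (fromℕ-nonneg (m ℕ.^ k)) x≤m ⟩
    fromℕ m * fromℕ (m ℕ.^ k)     ≈⟨ fromℕ-* m (m ℕ.^ k) ⟨
    fromℕ (m ℕ.^ suc k)           ∎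

  exp-bounded : ∀ m .{{_ : ℕ.NonZero m}} {x y} → 0# ≤ x → x ≤ fromℕ m →
                IsExp x y → y ≤ fromℕ (expBound m)
  exp-bounded m {x} {y} 0≤x x≤m (a , k!a≈x^k , ∑a⟶y) = ⟶-upper ∑a⟶y λ n → begin
    ∑< n a               ≤⟨ ∑<-geometric n (fromℕ-nonneg C) terms ⟩
    fromℕ C + fromℕ C    ≈⟨ fromℕ-+ C C ⟨
    fromℕ (C ℕ.+ C)      ∎
    where
    2m = 2 ℕ.* m
    C  = 2m ℕ.^ 2m
    terms : ∀ k → fromℕ (2 ℕ.^ k) * a k ≤ fromℕ C
    -- Multiplying by `k !` turns `a k` into `x ^ k`, and `2 ^ k` is then absorbed into the base
    -- `2m`.
    terms k = *-cancelˡ-≤ (fromℕ-pos (k !) {{k ℕ.!≢0}}) (begin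
      fromℕ (k !) * (fromℕ (2 ℕ.^ k) * a k)    ≈⟨ *-swap _ _ _ ⟩
      fromℕ (2 ℕ.^ k) * (fromℕ (k !) * a k)    ≈⟨ *-congˡ (k!a≈x^k k) ⟩
      fromℕ (2 ℕ.^ k) * x ^ k                  ≤⟨ *-monoʳ-≤ (fromℕ-nonneg (2 ℕ.^ k)) (^-≤-fromℕ 0≤x x≤m k) ⟩
      fromℕ (2 ℕ.^ k) * fromℕ (m ℕ.^ k)        ≈⟨ fromℕ-* (2 ℕ.^ k) (m ℕ.^ k) ⟨
      fromℕ (2 ℕ.^ k ℕ.* m ℕ.^ k)              ≡⟨ ≡.cong fromℕ (^-distrib-* 2 m k) ⟨
      fromℕ (2m ℕ.^ k)                         ≤⟨ fromℕ-mono-≤ (^≤^*! 2m {{ℕ.m*n≢0 2 m}} k) ⟩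
      fromℕ (C ℕ.* k !)                        ≈⟨ fromℕ-* C (k !) ⟩
      fromℕ C * fromℕ (k !)                    ≈⟨ *-comm _ _ ⟩
      fromℕ (k !) * fromℕ C                    ∎)

-- Strong induction along halving, which lowers the logarithm by one, while twice `⌊ n /2⌋` is at
-- most `n`.
2^⌊log₂n⌋≤n : ∀ n .{{_ : ℕ.NonZero n}} → 2 ℕ.^ ⌊log₂ n ⌋ ℕ.≤ n
2^⌊log₂n⌋≤n = <-rec (λ n → .{{_ : ℕ.NonZero n}} → 2 ℕ.^ ⌊log₂ n ⌋ ℕ.≤ n) λ where
    1             _   → ℕ.≤-refl
    (suc (suc n)) rec → step (suc (suc n)) (rec (ℕ.⌊n/2⌋<n (suc n)))
  where
  open ℕ.≤-Reasoning
  step : ∀ n → 2 ℕ.^ ⌊log₂ ℕ.⌊ n /2⌋ ⌋ ℕ.≤ ℕ.⌊ n /2⌋ → 2 ℕ.^ ⌊log₂ n ⌋ ℕ.≤ n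
  step n half = begin
    2 ℕ.^ ⌊log₂ n ⌋                    ≤⟨ ℕ.^-monoʳ-≤ 2 (ℕ.m≤n+m∸n ⌊log₂ n ⌋ 1) ⟩
    2 ℕ.* 2 ℕ.^ (⌊log₂ n ⌋ ℕ.∸ 1)      ≡⟨ ≡.cong (λ l → 2 ℕ.* 2 ℕ.^ l) (⌊log₂⌊n/2⌋⌋≡⌊log₂n⌋∸1 n) ⟨
    2 ℕ.* 2 ℕ.^ ⌊log₂ ℕ.⌊ n /2⌋ ⌋      ≤⟨ ℕ.*-monoʳ-≤ 2 half ⟩
    2 ℕ.* ℕ.⌊ n /2⌋                    ≡⟨ ≡.cong (ℕ.⌊ n /2⌋ ℕ.+_) (ℕ.+-identityʳ _) ⟩
    ℕ.⌊ n /2⌋ ℕ.+ ℕ.⌊ n /2⌋            ≤⟨ ℕ.+-monoʳ-≤ ℕ.⌊ n /2⌋ (ℕ.⌊n/2⌋≤⌈n/2⌉ n) ⟩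
    ℕ.⌊ n /2⌋ ℕ.+ ℕ.⌈ n /2⌉            ≡⟨ ℕ.⌊n/2⌋+⌈n/2⌉≡n n ⟩
    n                                  ∎

module _ {a} {A : Set a} where

  -- Pads a finite family to one indexed by `ℕ`, the form that countable additivity takes.
  extend : ∀ {m} → A → (Fin m → A) → ℕ → A
  extend {zero}  z f n       = z
  extend {suc m} z f zero    = f zero
  extend {suc m} z f (suc n) = extend z (f ∘ suc) n

  extend-toℕ : ∀ {m} z (f : Fin m → A) i → extend z f (toℕ i) ≡ f i
  extend-toℕ z f zero    = ≡.refl
  extend-toℕ z f (suc i) = extend-toℕ z (f ∘ suc) i

  extend-view : ∀ {m} z (f : Fin m → A) n →
                extend z f n ≡ z ⊎ ∃[ i ] (toℕ i ≡ n × extend z f n ≡ f i)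
  extend-view {zero}  z f n       = inj₁ ≡.refl
  extend-view {suc m} z f zero    = inj₂ (zero , ≡.refl , ≡.refl)
  extend-view {suc m} z f (suc n) with extend-view z (f ∘ suc) n
  ... | inj₁ eq             = inj₁ eq
  ... | inj₂ (i , i≡n , eq) = inj₂ (suc i , ≡.cong suc i≡n , eq)

-- Disjoint events and privacy

module RandomizedProperties (ℝ : RealField) where

  open Randomized ℝ hiding (zero)
  open ProbabilityMeasure using (Pr)
  open OrderedFieldProperties orderedField

  module _ {T : ℕ} (P : ProbabilityMeasure T) where

    open ProbabilityMeasure P using (nonnegative; total; monotone; additive)

    -- Countable additivity is applied to the family padded with `∅`. From index `n` on its partial
    -- sums dominate the finite sum, hence so does their limit, which is the probability of a union.
    ∑Pr≤1 : ∀ {n} (S : Fin n → Borel T) →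
            (∀ i j → i ≢ j → Pred.Empty (⟦ S i ⟧ Pred.∩ ⟦ S j ⟧)) →
            ∑ (Pr P ∘ S) ≤ 1#
    ∑Pr≤1 {n} S disjoint = begin
      ∑ (Pr P ∘ S)     ≡⟨ sum-cong-≗ (λ i → ≡.cong (Pr P) (extend-toℕ ∅ S i)) ⟨
      ∑< n (Pr P ∘ S⁺) ≤⟨ ⟶-lower n (additive S⁺ disjoint⁺) (λ _ → ∑<-mono-≤ (nonnegative ∘ S⁺)) ⟩
      Pr P (⋃ S⁺)      ≤⟨ monotone (λ _ ()) ⟩
      Pr P (∁ ∅)       ≈⟨ total ⟩
      1#               ∎
      where
      open ≤-Reasoning
      open SemiringSum semiring using (sum-cong-≗)
      S⁺ = extend ∅ S
      disjoint⁺ : ∀ i j → i ≢ j → Pred.Empty (⟦ S⁺ i ⟧ Pred.∩ ⟦ S⁺ j ⟧)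
      disjoint⁺ i j i≢j x (x∈i , x∈j) with extend-view ∅ S i | extend-view ∅ S j
      ... | inj₁ eq | _ = ≡.subst (λ S → ⟦ S ⟧ x) eq x∈i
      ... | inj₂ _ | inj₁ eq = ≡.subst (λ S → ⟦ S ⟧ x) eq x∈j
      ... | inj₂ (i′ , ≡.refl , eqᵢ) | inj₂ (j′ , ≡.refl , eqⱼ) =
        disjoint i′ j′ (i≢j ∘ ≡.cong toℕ) x
          (≡.subst (λ S → ⟦ S ⟧ x) eqᵢ x∈i , ≡.subst (λ S → ⟦ S ⟧ x) eqⱼ x∈j)

    packing : ∀ {n x b} (S : Fin n → Borel T) → 0# ≤ b →
              (∀ i j → i ≢ j → Pred.Empty (⟦ S i ⟧ Pred.∩ ⟦ S j ⟧)) →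
              (∀ i → x ≤ b * Pr P (S i)) → fromℕ n * x ≤ b
    packing {n} {x} {b} S 0≤b disjoint x≤bPr = begin
      fromℕ n * x         ≤⟨ ∑-lower (Pr P ∘ S) x≤bPr ⟩
      b * ∑ (Pr P ∘ S)    ≤⟨ *-monoʳ-≤ 0≤b (∑Pr≤1 S disjoint) ⟩
      b * 1#              ≈⟨ *-identityʳ b ⟩
      b                   ∎
      where open ≤-Reasoning

  AdjacentRatioBound : ∀ {W T} → Carrier → Algorithm W T → Set
  AdjacentRatioBound b 𝒜 =
    ∀ 𝒢 𝒢′ → NodeAdjacent 𝒢 𝒢′ → ∀ S → Pr[ 𝒢 ]∈ S ≤ b * Pr[ 𝒢′ ]∈ S
    where open Algorithm 𝒜

  -- A natural number depending only on `m` replaces `e^ε`, so that the later counting takes place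
  -- in `ℕ`.
  privacy-bounded : ∀ {W T ε} m .{{_ : ℕ.NonZero m}} → 0# ≤ ε → ε ≤ fromℕ m →
    (𝒜 : Algorithm W T) → IsNodePrivate ε 𝒜 → AdjacentRatioBound (fromℕ (expBound m)) 𝒜
  privacy-bounded m 0≤ε ε≤m 𝒜 (_ , exp , private-ε) 𝒢 𝒢′ adj S =
    ≤-trans (private-ε 𝒢 𝒢′ adj S) (*-monoˡ-≤ (nonnegative S) (exp-bounded m 0≤ε ε≤m exp))
    where open ProbabilityMeasure (Algorithm.law 𝒜 𝒢′) using (nonnegative)

  -- Packing applied to the pendant sequences

  module Packing {W T′ : ℕ} (1≤W : 1 ℕ.≤ W) (k : ℕ) (𝒜 : Algorithm W (suc T′))
    (B : ℕ) (private-B : AdjacentRatioBound (fromℕ B) 𝒜) where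

    open Algorithm 𝒜

    T = suc T′
    K = suc k

    open Pendants W K 1≤W

    -- A burst of `growth 0` inserts nothing whatever its time, so `zero` stands for any time.
    quiet : IncrementalSequence W T
    quiet = pendantSequence zero 0 z≤n

    -- Each removed leaf costs one factor `B`. The induction starts at one leaf, so that the last
    -- removal leads directly to `quiet`: a burst of nothing at `j` agrees with `quiet` pointwise,
    -- by `burst-none`.
    group-privacy : ∀ (j : Fin T) l (l<K : l ℕ.< K) S →
      Pr[ pendantSequence j (suc l) l<K ]∈ S ≤ fromℕ (B ℕ.^ suc l) * Pr[ quiet ]∈ S
    group-privacy j zero 0<K S = ≤-trans
      (private-B _ _ (adjacent j 0<K quiet ≡.refl
        (λ t → ≡.trans (burst-none zero t) (≡.sym (burst-none j t)))) S)
      (*-monoˡ-≤ (nonnegative S) (fromℕ-mono-≤ (ℕ.≤-reflexive (≡.sym (ℕ.^-identityʳ B)))))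
      where open ProbabilityMeasure (Algorithm.law 𝒜 quiet) using (nonnegative)
    group-privacy j (suc l) l+1<K S = begin
      Pr[ pendantSequence j (2 ℕ.+ l) l+1<K ]∈ S
        ≤⟨ private-B _ _ (adjacent j l+1<K _ ≡.refl (λ _ → ≡.refl)) S ⟩
      fromℕ B * Pr[ pendantSequence j (suc l) l<K ]∈ S
        ≤⟨ *-monoʳ-≤ (fromℕ-nonneg B) (group-privacy j l l<K S) ⟩
      fromℕ B * (fromℕ (B ℕ.^ suc l) * Pr[ quiet ]∈ S)
        ≈⟨ *-assoc _ _ _ ⟨
      fromℕ B * fromℕ (B ℕ.^ suc l) * Pr[ quiet ]∈ S
        ≈⟨ *-congʳ (fromℕ-* B (B ℕ.^ suc l)) ⟨
      fromℕ (B ℕ.^ (2 ℕ.+ l)) * Pr[ quiet ]∈ S ∎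
      where
      open ≤-Reasoning
      l<K = ℕ.<⇒≤ l+1<K

    full : Fin T → IncrementalSequence W T
    full j = pendantSequence j K ℕ.≤-refl

    full-max-early : ∀ {j t} → t Fin.< j → IsMaxMatchingWeight (current (full j) t) 0
    -- `insert anchors (growth 0)` reduces to `anchors`, so the graph before the burst is the case
    -- `l = 0`.
    full-max-early {j} {t} t<j = ≡.subst (λ G → IsMaxMatchingWeight G 0)
      (≡.sym (graphAfter-early anchors (growth K) t<j)) (growth-max z≤n)

    full-max-now : ∀ j → IsMaxMatchingWeight (current (full j) j) (K ℕ.* W)
    full-max-now j = ≡.subst (λ G → IsMaxMatchingWeight G (K ℕ.* W))
      (≡.sym (graphAfter-now anchors (growth K) j)) (growth-max ℕ.≤-refl)

    -- At the earlier time `i` the optimum is already `K * W` in one sequence and still 0 in the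
    -- other, and `x i` is within `α` of both.
    accurate-overlap : ∀ {α i j} → i Fin.< j → Accurate α (full i) Pred.≬ Accurate α (full j) →
                       fromℕ (K ℕ.* W) ≤ α + α
    accurate-overlap {α} {i} {j} i<j (x , acc-i , acc-j) = begin
      fromℕ (K ℕ.* W)                           ≈⟨ x-z+z≈x _ (x i) ⟨
      -- The accuracy bound speaks of `x i - fromℕ 0`, and `fromℕ 0` is `0#`.
      (fromℕ (K ℕ.* W) - x i) + x i             ≈⟨ +-congˡ (x-z+z≈x (x i) 0#) ⟨
      (fromℕ (K ℕ.* W) - x i) + (x i - 0# + 0#) ≈⟨ +-congˡ (+-identityʳ _) ⟩
      (fromℕ (K ℕ.* W) - x i) + (x i - 0#)      ≤⟨ +-mono-≤ (proj₂ (acc-i i _ (full-max-now i)))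
                                                          (proj₁ (acc-j i _ (full-max-early i<j))) ⟩
      α + α                                     ∎
      where open ≤-Reasoning

    -- Group privacy transfers the bound `β` for each accurate event to the single law of `quiet`,
    -- where the events compete for total mass 1.
    few-times : ∀ {α β} → HasAdditiveError β α 𝒜 → ¬ (fromℕ (K ℕ.* W) ≤ α + α) →
                fromℕ T * β ≤ fromℕ (B ℕ.^ K)
    few-times {α} {β} error small = packing (law quiet) S (fromℕ-nonneg (B ℕ.^ K)) disjoint
      λ j → ≤-trans (proj₂ (proj₂ (error (full j)))) (group-privacy j k ℕ.≤-refl (S j))
      where
      S : Fin T → Borel T
      S j = proj₁ (error (full j))
      sound : ∀ j {x} → ⟦ S j ⟧ x → Accurate α (full j) x
      sound j = proj₁ (proj₁ (proj₂ (error (full j))))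
      disjoint : ∀ i j → i ≢ j → Pred.Empty (⟦ S i ⟧ Pred.∩ ⟦ S j ⟧)
      disjoint i j i≢j x (x∈i , x∈j) with Fin.<-cmp i j
      ... | tri< i<j _ _ = small (accurate-overlap i<j (x , sound i x∈i , sound j x∈j))
      ... | tri≈ _ i≡j _ = i≢j i≡j
      ... | tri> _ _ j<i = small (accurate-overlap j<i (x , sound j x∈j , sound i x∈i))

-- Choice of the constants and the final contradiction

theorem38 : (ℝ : RealField) → let open Randomized ℝ in
    ∀ ε₀ β → 0# < ε₀ → 0# < β →
    ∃[ c ] (0# < c × ∃[ T₀ ]
    (∀ T W → T₀ ℕ.≤ T → 1 ℕ.≤ W →
    ∀ ε → 0# < ε → ε ≤ ε₀ →
    (𝒜 : Algorithm W T) → IsNodePrivate ε 𝒜 →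
    ∀ α → HasAdditiveError β α 𝒜 →
    c * fromℕ (W ℕ.* ⌊log₂ T ⌋) ≤ α))
theorem38 ℝ ε₀ β 0<ε₀ 0<β =
  -- This threshold makes `⌊log₂ T ⌋` at least `2 * D`, and hence `K` at least 1.
  c , 0<c , 2 ℕ.^ (2 ℕ.* D) , bound
  where
  open Randomized ℝ hiding (zero)
  open OrderedFieldProperties orderedField
  open RandomizedProperties ℝ

  -- The successor makes `m` nonzero, as the bound on the exponential requires.
  m = suc (proj₁ (archimedean ε₀))
  ε₀≤m : ε₀ ≤ fromℕ m
  ε₀≤m = ≤-trans (<⇒≤ (proj₂ (archimedean ε₀))) (fromℕ-mono-≤ (ℕ.n≤1+n (proj₁ (archimedean ε₀))))

  B = expBound m
  1/β = proj₁ (inverse 0<β)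
  -- Exceeding `1/β`, `b` provides the strict inequality that `too-many` contradicts.
  b = proj₁ (archimedean 1/β)

  1<bβ : 1# < fromℕ b * β
  1<bβ = begin-strict
    1#           ≈⟨ proj₂ (inverse 0<β) ⟨
    β * 1/β      <⟨ *-monoʳ-< 0<β (proj₂ (archimedean 1/β)) ⟩
    β * fromℕ b  ≈⟨ *-comm β (fromℕ b) ⟩
    fromℕ b * β  ∎
    where open ≤-Reasoning

  -- 2 ^ D exceeds B and b, so K = ⌊ ⌊log₂ T ⌋ / 2D ⌋ gives b B ^ K ≤ T. The scale
  -- c = 1 / 8D then combines ⌊log₂ T ⌋ ≤ 4DK with K W ≤ 2 α.
  D = B ℕ.+ b

  instance
    B≢0 : ℕ.NonZero B
    B≢0 = expBound-nonZero m
    D≢0 : ℕ.NonZero D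
    D≢0 = ℕ.>-nonZero (ℕ.<-≤-trans (ℕ.>-nonZero⁻¹ B) (ℕ.m≤m+n B b))
    2D≢0 : ℕ.NonZero (2 ℕ.* D)
    2D≢0 = ℕ.m*n≢0 2 D
    8D≢0 : ℕ.NonZero (4 ℕ.* D ℕ.* 2)
    8D≢0 = ℕ.m*n≢0 (4 ℕ.* D) 2 {{ℕ.m*n≢0 4 D}}

  c = proj₁ (reciprocal (4 ℕ.* D ℕ.* 2))
  0<c = proj₁ (proj₂ (reciprocal (4 ℕ.* D ℕ.* 2)))
  8Dc≈1 = proj₂ (proj₂ (reciprocal (4 ℕ.* D ℕ.* 2)))

  -- Both `b` and `B` are at most `2 ^ D`. As `K` is positive, `b` costs at most a second factor
  -- `(2 ^ D) ^ K`, whence `2 * D` per unit of `K`.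
  many-times : ∀ {T K} .{{_ : ℕ.NonZero T}} → 1 ℕ.≤ K → K ℕ.* (2 ℕ.* D) ℕ.≤ ⌊log₂ T ⌋ →
               b ℕ.* B ℕ.^ K ℕ.≤ T
  many-times {T} {K} 1≤K 2DK≤log = begin
    b ℕ.* B ℕ.^ K                      ≤⟨ ℕ.*-mono-≤ (≤2^D (ℕ.m≤n+m b B)) (ℕ.^-monoˡ-≤ K (≤2^D (ℕ.m≤m+n B b))) ⟩
    2 ℕ.^ D ℕ.* (2 ℕ.^ D) ℕ.^ K        ≤⟨ ℕ.*-monoˡ-≤ _ 2^D≤ ⟩
    (2 ℕ.^ D) ℕ.^ K ℕ.* (2 ℕ.^ D) ℕ.^ K  ≡⟨ ℕ.^-distribˡ-+-* (2 ℕ.^ D) K K ⟨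
    (2 ℕ.^ D) ℕ.^ (K ℕ.+ K)            ≡⟨ ℕ.^-*-assoc 2 D (K ℕ.+ K) ⟩
    2 ℕ.^ (D ℕ.* (K ℕ.+ K))            ≡⟨ ≡.cong (2 ℕ.^_) (solve 2 (λ D K → D :* (K :+ K) :=
                                            K :* (con 2 :* D)) ≡.refl D K) ⟩
    2 ℕ.^ (K ℕ.* (2 ℕ.* D))            ≤⟨ ℕ.^-monoʳ-≤ 2 2DK≤log ⟩
    2 ℕ.^ ⌊log₂ T ⌋                    ≤⟨ 2^⌊log₂n⌋≤n T ⟩
    T                                  ∎
    where
    open ℕ.≤-Reasoning
    open +-*-Solver
    2^D≤ : 2 ℕ.^ D ℕ.≤ (2 ℕ.^ D) ℕ.^ K
    2^D≤ = ≡.subst (ℕ._≤ (2 ℕ.^ D) ℕ.^ K) (ℕ.^-identityʳ (2 ℕ.^ D))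
                   (ℕ.^-monoʳ-≤ (2 ℕ.^ D) {{ℕ.m^n≢0 2 D}} 1≤K)
    ≤2^D : ∀ {n} → n ℕ.≤ D → n ℕ.≤ 2 ℕ.^ D
    ≤2^D n≤D = ℕ.≤-trans n≤D (n≤2^n D)

  -- The remainder of `L` modulo `2 * D` is below `2 * D`, hence at most `K * (2 * D)`.
  log-bounded : ∀ L W {K} → 1 ℕ.≤ K → K ≡ L ℕ./ (2 ℕ.* D) → W ℕ.* L ℕ.≤ 4 ℕ.* D ℕ.* (K ℕ.* W)
  log-bounded L W {K} 1≤K ≡.refl = begin
    W ℕ.* L                                          ≡⟨ ≡.cong (W ℕ.*_) (ℕ.m≡m%n+[m/n]*n L (2 ℕ.* D)) ⟩
    W ℕ.* (L ℕ.% (2 ℕ.* D) ℕ.+ K ℕ.* (2 ℕ.* D))      ≤⟨ ℕ.*-monoʳ-≤ W (ℕ.+-monoˡ-≤ _ (ℕ.<⇒≤ (ℕ.m%n<n L (2 ℕ.* D)))) ⟩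
    W ℕ.* (2 ℕ.* D ℕ.+ K ℕ.* (2 ℕ.* D))              ≤⟨ ℕ.*-monoʳ-≤ W (ℕ.+-monoˡ-≤ _
                                                          (ℕ.m≤n*m (2 ℕ.* D) K {{ℕ.>-nonZero 1≤K}})) ⟩
    W ℕ.* (K ℕ.* (2 ℕ.* D) ℕ.+ K ℕ.* (2 ℕ.* D))      ≡⟨ solve 3 (λ D K W → W :* (K :* (con 2 :* D) :+ K :* (con 2 :* D)) :=
                                                           con 4 :* D :* (K :* W)) ≡.refl D K W ⟩
    4 ℕ.* D ℕ.* (K ℕ.* W)                            ∎
    where
    open ℕ.≤-Reasoning
    open +-*-Solver

  -- In the scale `4 * D * 2`, the factor `4 * D` comes from the bound on the logarithm and the 2
  -- from `α + α`; its product with `c` is 1.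
  small : ∀ {L W K α} → W ℕ.* L ℕ.≤ 4 ℕ.* D ℕ.* (K ℕ.* W) →
          α < c * fromℕ (W ℕ.* L) → ¬ (fromℕ (K ℕ.* W) ≤ α + α)
  small {L} {W} {K} {α} WL≤4DKW α<cWL KW≤2α = begin-contradiction
    fromℕ (W ℕ.* L)                              ≤⟨ fromℕ-mono-≤ WL≤4DKW ⟩
    fromℕ (4 ℕ.* D ℕ.* (K ℕ.* W))                ≈⟨ fromℕ-* (4 ℕ.* D) (K ℕ.* W) ⟩
    fromℕ (4 ℕ.* D) * fromℕ (K ℕ.* W)            ≤⟨ *-monoʳ-≤ (fromℕ-nonneg (4 ℕ.* D)) KW≤2α ⟩
    fromℕ (4 ℕ.* D) * (α + α)                    ≈⟨ *-congˡ (+-congˡ (+-identityʳ α)) ⟨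
    fromℕ (4 ℕ.* D) * (2 · α)                    ≈⟨ *-congˡ (fromℕ-*-· 2 α) ⟨
    fromℕ (4 ℕ.* D) * (fromℕ 2 * α)              ≈⟨ *-assoc _ _ _ ⟨
    fromℕ (4 ℕ.* D) * fromℕ 2 * α                ≈⟨ *-congʳ (fromℕ-* (4 ℕ.* D) 2) ⟨
    fromℕ (4 ℕ.* D ℕ.* 2) * α                    <⟨ *-monoʳ-< (fromℕ-pos (4 ℕ.* D ℕ.* 2)) α<cWL ⟩
    fromℕ (4 ℕ.* D ℕ.* 2) * (c * fromℕ (W ℕ.* L))  ≈⟨ *-assoc _ _ _ ⟨
    fromℕ (4 ℕ.* D ℕ.* 2) * c * fromℕ (W ℕ.* L)  ≈⟨ *-congʳ 8Dc≈1 ⟩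
    1# * fromℕ (W ℕ.* L)                         ≈⟨ *-identityˡ _ ⟩
    fromℕ (W ℕ.* L)                              ∎
    where open ≤-Reasoning

  too-many : ∀ {T K} → b ℕ.* B ℕ.^ K ℕ.≤ T → ¬ (fromℕ T * β ≤ fromℕ (B ℕ.^ K))
  too-many {T} {K} bB^K≤T Tβ≤B^K = begin-contradiction
    fromℕ T * β                      ≤⟨ Tβ≤B^K ⟩
    fromℕ (B ℕ.^ K)                  ≈⟨ *-identityʳ _ ⟨
    fromℕ (B ℕ.^ K) * 1#             <⟨ *-monoʳ-< (fromℕ-pos (B ℕ.^ K) {{ℕ.m^n≢0 B K}}) 1<bβ ⟩
    fromℕ (B ℕ.^ K) * (fromℕ b * β)  ≈⟨ *-assoc _ _ _ ⟨
    fromℕ (B ℕ.^ K) * fromℕ b * β    ≈⟨ *-congʳ (*-comm _ _) ⟩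
    fromℕ b * fromℕ (B ℕ.^ K) * β    ≈⟨ *-congʳ (fromℕ-* b (B ℕ.^ K)) ⟨
    fromℕ (b ℕ.* B ℕ.^ K) * β        ≤⟨ *-monoˡ-≤ (<⇒≤ 0<β) (fromℕ-mono-≤ bB^K≤T) ⟩
    fromℕ T * β                      ∎
    where open ≤-Reasoning

  bound : ∀ T W → 2 ℕ.^ (2 ℕ.* D) ℕ.≤ T → 1 ℕ.≤ W →
          ∀ ε → 0# < ε → ε ≤ ε₀ → (𝒜 : Algorithm W T) → IsNodePrivate ε 𝒜 →
          ∀ α → HasAdditiveError β α 𝒜 → c * fromℕ (W ℕ.* ⌊log₂ T ⌋) ≤ α
  bound zero W T₀≤0 = ⊥-elim (ℕ.<⇒≱ (ℕ.m^n>0 2 (2 ℕ.* D)) T₀≤0)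
  -- The goal is a negation, so its last argument `α<cWL` is the inequality to refute.
  bound T@(suc _) W T₀≤T 1≤W ε 0<ε ε≤ε₀ 𝒜 private-ε α error α<cWL =
    refute (L ℕ./ (2 ℕ.* D)) ≡.refl (ℕ.m≥n⇒m/n>0 2D≤L)
    where
    L = ⌊log₂ T ⌋
    2D≤L : 2 ℕ.* D ℕ.≤ L
    2D≤L = ≡.subst (ℕ._≤ L) (⌊log₂[2^n]⌋≡n (2 ℕ.* D)) (⌊log₂⌋-mono-≤ T₀≤T)
    private-B = privacy-bounded m (<⇒≤ 0<ε) (≤-trans ε≤ε₀ ε₀≤m) 𝒜 private-ε
    -- The quotient is generalised together with its equation, so that it can be matched as the
    -- successor that `Packing` expects.
    refute : ∀ K → K ≡ L ℕ./ (2 ℕ.* D) → 1 ℕ.≤ K → ⊥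
    refute K@(suc k) K≡L/2D 1≤K = too-many {T} {K} (many-times 1≤K 2DK≤L)
      (Packing.few-times 1≤W k 𝒜 B private-B error
        (small {L} {W} {K} (log-bounded L W 1≤K K≡L/2D) α<cWL))
      where
      2DK≤L : K ℕ.* (2 ℕ.* D) ℕ.≤ L
      2DK≤L = ≡.subst (λ K → K ℕ.* (2 ℕ.* D) ℕ.≤ L) (≡.sym K≡L/2D) (ℕ.m/n*n≤m L (2 ℕ.* D))
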